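{- For any set $\Gamma$ of formulas of intuitionistic propositional logic and any formula $\varphi$, $$\Gamma\vdash\varphi \quad\text{if and only if}\quad \Gamma\vDash_{alg}\varphi,$$ where $\Gamma\vdash\varphi$ is derivability from $\Gamma$ in the Hilbert-style proof system described in the context and $\Gamma\vDash_{alg}\varphi$ is algebraic semantic consequence over Heyting algebras.
   Context: Formulas: built from a countable set of propositional variables indexed by natural numbers ($Var=\{p_n : n\in\mathbb{N}\}$) and $\bot$ by the binary connectives $\wedge,\vee,\to$ ($\wedge,\vee$ bind more strongly than $\to$, which associates to the right). Proof system: for a set $\Gamma$ of formulas, $\Gamma\vdash\varphi$ is defined inductively. Base cases: $\Gamma\vdash\varphi$ for $\varphi\in\Gamma$; and for all formulas $\varphi,\psi$ the axioms $\varphi\vee\varphi\to\varphi$; $\varphi\to\varphi\wedge\varphi$; $\varphi\to\varphi\vee\psi$; $\varphi\wedge\psi\to\varphi$; $\varphi\vee\psi\to\psi\vee\varphi$; $\varphi\wedge\psi\to\psi\wedge\varphi$; $\bot\to\varphi$. Rules (for all $\varphi,\psi,\chi$): from $\Gamma\vdash\varphi$ and $\Gamma\vdash\varphi\to\psi$ infer $\Gamma\vdash\psi$; from $\Gamma\vdash\varphi\to\psi$ and $\Gamma\vdash\psi\to\chi$ infer $\Gamma\vdash\varphi\to\chi$; from $\Gamma\vdash\varphi\wedge\psi\to\chi$ infer $\Gamma\vdash\varphi\to(\psi\to\chi)$; from $\Gamma\vdash\varphi\to(\psi\to\chi)$ infer $\Gamma\vdash\varphi\wedge\psi\to\chi$;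 from $\Gamma\vdash\varphi\to\psi$ infer $\Gamma\vdash\chi\vee\varphi\to\chi\vee\psi$. Algebraic semantics: a Heyting algebra $H$ is a bounded lattice (least element $0$, greatest element $1$) with an operation $\to$ such that $a\le b\to c$ iff $a\wedge b\le c$. An algebraic interpretation in $H$ is a function $I$ from formulas to $H$ with $I(\bot)=0$, $I(\varphi\wedge\psi)=I(\varphi)\wedge I(\psi)$, $I(\varphi\vee\psi)=I(\varphi)\vee I(\psi)$, $I(\varphi\to\psi)=I(\varphi)\to I(\psi)$ for all formulas $\varphi,\psi$ (thus it is determined by its arbitrary values on variables). An algebraic model is a pair $(H,I)$. A formula $\varphi$ is true in $(H,I)$ if $I(\varphi)=1$; a set $\Gamma$ is true in $(H,I)$ if all its members are. $\Gamma\vDash_{alg}\varphi$ means: for every algebraic model $(H,I)$, if $\Gamma$ is true in $(H,I)$ then $\varphi$ is true in $(H,I)$. -}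

module Defs where

open import Data.Nat.Base using (ℕ)
open import Level using (Level; _⊔_; suc)
open import Relation.Binary.Lattice using (HeytingAlgebra)
open import Relation.Unary using (Pred; _∈_)

private
  variable
    ℓ : Level

infixr 7 _∧_ _∨_
infixr 5 _⇒_
infix  3 _⊢_

data Formula : Set where
  var         : ℕ → Formula
  ⊥           : Formula
  _∧_ _∨_ _⇒_ : Formula → Formula → Formula

data _⊢_ (Γ : Pred Formula ℓ) : Formula → Set ℓ where
  hyp        : ∀ {φ} → φ ∈ Γ → Γ ⊢ φ
  ∨-contract : ∀ {φ} → Γ ⊢ φ ∨ φ ⇒ φ
  ∧-contract : ∀ {φ} → Γ ⊢ φ ⇒ φ ∧ φ
  ∨-weaken   : ∀ {φ ψ} → Γ ⊢ φ ⇒ φ ∨ ψ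
  ∧-weaken   : ∀ {φ ψ} → Γ ⊢ φ ∧ ψ ⇒ φ
  ∨-permute  : ∀ {φ ψ} → Γ ⊢ φ ∨ ψ ⇒ ψ ∨ φ
  ∧-permute  : ∀ {φ ψ} → Γ ⊢ φ ∧ ψ ⇒ ψ ∧ φ
  ex-falso   : ∀ {φ} → Γ ⊢ ⊥ ⇒ φ
  mp         : ∀ {φ ψ} → Γ ⊢ φ → Γ ⊢ φ ⇒ ψ → Γ ⊢ ψ
  syllogism  : ∀ {φ ψ χ} → Γ ⊢ φ ⇒ ψ → Γ ⊢ ψ ⇒ χ → Γ ⊢ φ ⇒ χ
  exportation : ∀ {φ ψ χ} → Γ ⊢ φ ∧ ψ ⇒ χ → Γ ⊢ φ ⇒ (ψ ⇒ χ)
  importation : ∀ {φ ψ χ} → Γ ⊢ φ ⇒ (ψ ⇒ χ) → Γ ⊢ φ ∧ ψ ⇒ χ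
  expansion  : ∀ {φ ψ χ} → Γ ⊢ φ ⇒ ψ → Γ ⊢ χ ∨ φ ⇒ χ ∨ ψ

-- Equality in a Heyting algebra is its setoid equality _≈_, which is the
-- equivalence associated with the order (antisymmetry holds up to _≈_).
record Interpretation {c ℓ₁ ℓ₂} (H : HeytingAlgebra c ℓ₁ ℓ₂) : Set (c ⊔ ℓ₁) where
  private module H = HeytingAlgebra H
  open H using (_≈_)
  field
    ⟦_⟧    : Formula → H.Carrier
    ⟦⟧-⊥   : ⟦ ⊥ ⟧ ≈ H.⊥
    ⟦⟧-∧   : ∀ φ ψ → ⟦ φ ∧ ψ ⟧ ≈ ⟦ φ ⟧ H.∧ ⟦ ψ ⟧
    ⟦⟧-∨   : ∀ φ ψ → ⟦ φ ∨ ψ ⟧ ≈ ⟦ φ ⟧ H.∨ ⟦ ψ ⟧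
    ⟦⟧-⇒   : ∀ φ ψ → ⟦ φ ⇒ ψ ⟧ ≈ ⟦ φ ⟧ H.⇨ ⟦ ψ ⟧

record AlgebraicModel c ℓ₁ ℓ₂ : Set (suc (c ⊔ ℓ₁ ⊔ ℓ₂)) where
  field
    algebra        : HeytingAlgebra c ℓ₁ ℓ₂
    interpretation : Interpretation algebra
  open HeytingAlgebra algebra public using (_≈_; ⊤)
  open Interpretation interpretation public

TrueIn : ∀ {c ℓ₁ ℓ₂} → AlgebraicModel c ℓ₁ ℓ₂ → Formula → Set ℓ₁
TrueIn M φ = ⟦ φ ⟧ ≈ ⊤
  where open AlgebraicModel M

AllTrueIn : ∀ {c ℓ₁ ℓ₂} → AlgebraicModel c ℓ₁ ℓ₂ → Pred Formula ℓ → Set (ℓ ⊔ ℓ₁)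
AllTrueIn M Γ = ∀ ψ → ψ ∈ Γ → TrueIn M ψ

-- The level arguments bound the size of the models quantified over.
AlgConsequence : ∀ c ℓ₁ ℓ₂ → Pred Formula ℓ → Formula → Set (ℓ ⊔ suc (c ⊔ ℓ₁ ⊔ ℓ₂))
AlgConsequence c ℓ₁ ℓ₂ Γ φ =
  (M : AlgebraicModel c ℓ₁ ℓ₂) → AllTrueIn M Γ → TrueIn M φ

syntax AlgConsequence c ℓ₁ ℓ₂ Γ φ = Γ ⊨alg[ c , ℓ₁ , ℓ₂ ] φ
infix 3 AlgConsequence

{-# OPTIONS --safe #-}

-- Soundness is an induction on derivations, as x ⇨ y ≈ ⊤ exactly when x ≤ y.
-- For completeness, formulas preordered by Γ ⊢ φ ⇒ ψ form a Heyting algebra (the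
-- Lindenbaum algebra of Γ) whose top element is the class of the formulas derivable from Γ;
-- interpreting each formula by itself gives a model of Γ in which only those are true.
module Submission where

open import Defs
open import Data.Product.Base using (_×_; _,_; proj₁; proj₂; swap; zip)
open import Function.Base using (flip)
open import Function.Bundles using (_⇔_; mk⇔)
open import Level using (Level; _⊔_; Lift; lift)
open import Relation.Binary.Lattice using (HeytingAlgebra)
open import Relation.Unary using (Pred)

module _ {c ℓ₁ ℓ₂} (H : HeytingAlgebra c ℓ₁ ℓ₂) where
  open HeytingAlgebra H

  ⊤≤⇒≈⊤ : ∀ {x} → ⊤ ≤ x → x ≈ ⊤
  ⊤≤⇒≈⊤ = antisym (maximum _)

  ≤⇒⇨≈⊤ : ∀ {x y} → x ≤ y → x ⇨ y ≈ ⊤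
  ≤⇒⇨≈⊤ x≤y = ⊤≤⇒≈⊤ (transpose-⇨ (trans (x∧y≤y _ _) x≤y))

  -- Residuation turns `⊤ ≤ x ⇨ y` into `⊤ ∧ x ≤ y`, and `x ≤ ⊤ ∧ x`.
  ⇨≈⊤⇒≤ : ∀ {x y} → x ⇨ y ≈ ⊤ → x ≤ y
  ⇨≈⊤⇒≤ {x} eq =
    trans (∧-greatest (maximum x) refl) (transpose-∧ (reflexive (Eq.sym eq)))

module Soundness {ℓ c ℓ₁ ℓ₂} {Γ : Pred Formula ℓ}
  (M : AlgebraicModel c ℓ₁ ℓ₂) (M⊨Γ : AllTrueIn M Γ) where

  open AlgebraicModel M using (algebra; ⟦_⟧; ⟦⟧-⊥; ⟦⟧-∧; ⟦⟧-∨; ⟦⟧-⇒)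
  open HeytingAlgebra algebra hiding (_∧_; _∨_; ⊥)

  ≤⇒true : ∀ {φ ψ} → ⟦ φ ⟧ ≤ ⟦ ψ ⟧ → TrueIn M (φ ⇒ ψ)
  ≤⇒true φ≤ψ = Eq.trans (⟦⟧-⇒ _ _) (≤⇒⇨≈⊤ algebra φ≤ψ)

  true⇒≤ : ∀ {φ ψ} → TrueIn M (φ ⇒ ψ) → ⟦ φ ⟧ ≤ ⟦ ψ ⟧
  true⇒≤ t = ⇨≈⊤⇒≤ algebra (Eq.trans (Eq.sym (⟦⟧-⇒ _ _)) t)

  -- An interpretation commutes with the connectives only up to `≈`. This lemma and those up to
  -- `∧-≤` absorb that transport once, so that each axiom and rule becomes an order law between
  -- interpreted formulas.
  ≤-∧ : ∀ {x φ ψ} → x ≤ ⟦ φ ⟧ → x ≤ ⟦ ψ ⟧ → x ≤ ⟦ φ ∧ ψ ⟧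
  ≤-∧ p q = trans (∧-greatest p q) (reflexive (Eq.sym (⟦⟧-∧ _ _)))

  ∧-≤₁ : ∀ {φ ψ} → ⟦ φ ∧ ψ ⟧ ≤ ⟦ φ ⟧
  ∧-≤₁ = trans (reflexive (⟦⟧-∧ _ _)) (x∧y≤x _ _)

  ∧-≤₂ : ∀ {φ ψ} → ⟦ φ ∧ ψ ⟧ ≤ ⟦ ψ ⟧
  ∧-≤₂ = trans (reflexive (⟦⟧-∧ _ _)) (x∧y≤y _ _)

  ∨-≤ : ∀ {x φ ψ} → ⟦ φ ⟧ ≤ x → ⟦ ψ ⟧ ≤ x → ⟦ φ ∨ ψ ⟧ ≤ x
  ∨-≤ p q = trans (reflexive (⟦⟧-∨ _ _)) (∨-least p q)

  ≤-∨₁ : ∀ {φ ψ} → ⟦ φ ⟧ ≤ ⟦ φ ∨ ψ ⟧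
  ≤-∨₁ = trans (x≤x∨y _ _) (reflexive (Eq.sym (⟦⟧-∨ _ _)))

  ≤-∨₂ : ∀ {φ ψ} → ⟦ ψ ⟧ ≤ ⟦ φ ∨ ψ ⟧
  ≤-∨₂ = trans (y≤x∨y _ _) (reflexive (Eq.sym (⟦⟧-∨ _ _)))

  ≤-⇒ : ∀ {φ ψ χ} → ⟦ φ ∧ ψ ⟧ ≤ ⟦ χ ⟧ → ⟦ φ ⟧ ≤ ⟦ ψ ⇒ χ ⟧
  ≤-⇒ p = trans (transpose-⇨ (trans (reflexive (Eq.sym (⟦⟧-∧ _ _))) p))
                (reflexive (Eq.sym (⟦⟧-⇒ _ _)))

  ∧-≤ : ∀ {φ ψ χ} → ⟦ φ ⟧ ≤ ⟦ ψ ⇒ χ ⟧ → ⟦ φ ∧ ψ ⟧ ≤ ⟦ χ ⟧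
  ∧-≤ p = trans (reflexive (⟦⟧-∧ _ _))
                (transpose-∧ (trans p (reflexive (⟦⟧-⇒ _ _))))

  sound : ∀ {φ} → Γ ⊢ φ → TrueIn M φ
  sound (hyp φ∈Γ)       = M⊨Γ _ φ∈Γ
  sound ∨-contract      = ≤⇒true (∨-≤ refl refl)
  sound ∧-contract      = ≤⇒true (≤-∧ refl refl)
  sound ∨-weaken        = ≤⇒true ≤-∨₁
  sound ∧-weaken        = ≤⇒true ∧-≤₁
  sound ∨-permute       = ≤⇒true (∨-≤ ≤-∨₂ ≤-∨₁)
  sound ∧-permute       = ≤⇒true (≤-∧ ∧-≤₂ ∧-≤₁)
  sound ex-falso        = ≤⇒true (trans (reflexive ⟦⟧-⊥) (minimum _))
  sound (mp p q)        =
    ⊤≤⇒≈⊤ algebra (trans (reflexive (Eq.sym (sound p))) (true⇒≤ (sound q)))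
  sound (syllogism p q) = ≤⇒true (trans (true⇒≤ (sound p)) (true⇒≤ (sound q)))
  sound (exportation p) = ≤⇒true (≤-⇒ (true⇒≤ (sound p)))
  sound (importation p) = ≤⇒true (∧-≤ (true⇒≤ (sound p)))
  sound (expansion p)   = ≤⇒true (∨-≤ ≤-∨₁ (trans (true⇒≤ (sound p)) ≤-∨₂))

module _ {ℓ} {Γ : Pred Formula ℓ} where

  ⇒-refl : ∀ {φ} → Γ ⊢ φ ⇒ φ
  ⇒-refl = syllogism ∧-contract ∧-weaken

  ⇒-const : ∀ {φ ψ} → Γ ⊢ φ → Γ ⊢ ψ ⇒ φ
  ⇒-const p = mp p (exportation ∧-weaken)

  ∧-weakenʳ : ∀ {φ ψ} → Γ ⊢ φ ∧ ψ ⇒ ψ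
  ∧-weakenʳ = syllogism ∧-permute ∧-weaken

  ∨-weakenʳ : ∀ {φ ψ} → Γ ⊢ ψ ⇒ φ ∨ ψ
  ∨-weakenʳ = syllogism ∨-weaken ∨-permute

  -- Exporting the identity on `ψ ∧ χ` gives `ψ ⇒ (χ ⇒ ψ ∧ χ)`; precompose with `φ ⇒ ψ` and import.
  ∧-monoˡ : ∀ {φ ψ χ} → Γ ⊢ φ ⇒ ψ → Γ ⊢ φ ∧ χ ⇒ ψ ∧ χ
  ∧-monoˡ p = importation (syllogism p (exportation ⇒-refl))

  -- Duplicate `χ`, then rewrite one copy at a time. `∧-monoˡ` acts only on the left, hence the
  -- swap: `χ ∧ χ`, `ψ ∧ χ`, `χ ∧ ψ`, `φ ∧ ψ`.
  ∧-intro : ∀ {φ ψ χ} → Γ ⊢ χ ⇒ φ → Γ ⊢ χ ⇒ ψ → Γ ⊢ χ ⇒ φ ∧ ψ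
  ∧-intro p q = syllogism (syllogism ∧-contract (∧-monoˡ q))
                          (syllogism ∧-permute (∧-monoˡ p))

  -- Dually, `expansion` acts only on the right disjunct: `φ ∨ ψ`, `φ ∨ χ`, `χ ∨ φ`, `χ ∨ χ`, then
  -- contract.
  ∨-elim : ∀ {φ ψ χ} → Γ ⊢ φ ⇒ χ → Γ ⊢ ψ ⇒ χ → Γ ⊢ φ ∨ ψ ⇒ χ
  ∨-elim p q = syllogism (syllogism (expansion q) ∨-permute)
                         (syllogism (expansion p) ∨-contract)

module Completeness {ℓ} (c ℓ₁ ℓ₂ : Level) (Γ : Pred Formula ℓ) where

  -- Setoid equality replaces the quotient by interderivability. Derivations from `Γ` live at level
  -- `ℓ`, so both relations are at least that large; `Lift` raises everything to the requested
  -- levels.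
  lindenbaumAlgebra : HeytingAlgebra c (ℓ ⊔ ℓ₁) (ℓ ⊔ ℓ₂)
  lindenbaumAlgebra = record
    { Carrier = Lift c Formula
    ; _≈_     = λ (lift φ) (lift ψ) → Lift ℓ₁ ((Γ ⊢ φ ⇒ ψ) × (Γ ⊢ ψ ⇒ φ))
    ; _≤_     = λ (lift φ) (lift ψ) → Lift ℓ₂ (Γ ⊢ φ ⇒ ψ)
    ; _∨_     = λ (lift φ) (lift ψ) → lift (φ ∨ ψ)
    ; _∧_     = λ (lift φ) (lift ψ) → lift (φ ∧ ψ)
    ; _⇨_     = λ (lift φ) (lift ψ) → lift (φ ⇒ ψ)
    -- The language has no constant for truth; `⊥ ⇒ ⊥` is a closed derivable formula.
    ; ⊤       = lift (⊥ ⇒ ⊥)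
    ; ⊥       = lift ⊥
    ; isHeytingAlgebra = record
      { isBoundedLattice = record
        { isLattice = record
          { isPartialOrder = record
            { isPreorder = record
              { isEquivalence = record
                { refl  = lift (⇒-refl , ⇒-refl)
                ; sym   = λ (lift p) → lift (swap p)
                ; trans = λ (lift p) (lift q) → lift (zip syllogism (flip syllogism) p q)
                }
              ; reflexive = λ (lift p) → lift (proj₁ p)
              ; trans     = λ (lift p) (lift q) → lift (syllogism p q)
              }
            ; antisym = λ (lift p) (lift q) → lift (p , q)
            }
          ; supremum = λ _ _ → lift ∨-weaken , lift ∨-weakenʳ ,
                               λ _ (lift p) (lift q) → lift (∨-elim p q)
          ; infimum  = λ _ _ → lift ∧-weaken , lift ∧-weakenʳ ,
                               λ _ (lift p) (lift q) → lift (∧-intro p q)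
          }
        ; maximum = λ _ → lift (⇒-const ⇒-refl)
        ; minimum = λ _ → lift ex-falso
        }
      -- The two currying rules are exactly the residuation law.
      ; exponential = λ _ _ _ → (λ (lift p) → lift (exportation p)) ,
                                (λ (lift p) → lift (importation p))
      }
    }

  lindenbaumModel : AlgebraicModel c (ℓ ⊔ ℓ₁) (ℓ ⊔ ℓ₂)
  lindenbaumModel = record
    { algebra        = lindenbaumAlgebra
    ; interpretation = record
      { ⟦_⟧  = lift
      ; ⟦⟧-⊥ = Eq.refl
      ; ⟦⟧-∧ = λ _ _ → Eq.refl
      ; ⟦⟧-∨ = λ _ _ → Eq.refl
      ; ⟦⟧-⇒ = λ _ _ → Eq.refl
      }
    }
    where open HeytingAlgebra lindenbaumAlgebra using (module Eq)

  derivable⇒true : ∀ {φ} → Γ ⊢ φ → TrueIn lindenbaumModel φ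
  derivable⇒true p = lift (⇒-const ⇒-refl , ⇒-const p)

  true⇒derivable : ∀ {φ} → TrueIn lindenbaumModel φ → Γ ⊢ φ
  -- Here `p` derives `(⊥ ⇒ ⊥) ⇒ φ`, whose premise is an instance of `⇒-refl`.
  true⇒derivable (lift (_ , p)) = mp ⇒-refl p

  complete : ∀ {φ} → Γ ⊨alg[ c , ℓ ⊔ ℓ₁ , ℓ ⊔ ℓ₂ ] φ → Γ ⊢ φ
  complete Γ⊨φ = true⇒derivable (Γ⊨φ lindenbaumModel λ _ ψ∈Γ → derivable⇒true (hyp ψ∈Γ))

mainTheorem2 : {ℓ : Level} (c ℓ₁ ℓ₂ : Level) (Γ : Pred Formula ℓ) (φ : Formula) →
    (Γ ⊢ φ) ⇔ (Γ ⊨alg[ c , ℓ ⊔ ℓ₁ , ℓ ⊔ ℓ₂ ] φ)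
mainTheorem2 c ℓ₁ ℓ₂ Γ φ = mk⇔ (λ Γ⊢φ M M⊨Γ → sound M M⊨Γ Γ⊢φ) (complete c ℓ₁ ℓ₂ Γ)
  where
  open Soundness using (sound)
  open Completeness using (complete)
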